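{- For every integer $k \geq 5$ there is $n_0$ such that for all $n \geq n_0$, $s(n, \mathcal{C}_k) \geq \binom{n}{2} - (k-1)(2k-4)[n - (k-1)(2k-3)]$. This holds both when Mini moves first and when Max moves first.
   Context: Let $\mathcal{P}$ be a monotone increasing property of graphs on vertex set $[n]$. An edge $e \in \binom{[n]}{2}\setminus E(G)$ is legal with respect to a graph $G \notin \mathcal{P}$ if $G \cup \{e\} \notin \mathcal{P}$. The saturation game $(n,\mathcal{P})$: starting from the empty graph on $[n]$, two players, Mini and Max, alternately add a legal edge to the current graph $G$. The game ends when no legal edge exists. Max wants to maximize the number of edges of the final graph and Mini wants to minimize it. The score $s(n,\mathcal{P})$ is the number of edges of the final graph under optimal play by both players; it may depend on which player moves first. $\mathcal{C}_k$ denotes the property of being $k$-vertex-connected (on all $n$ vertices). -}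

module Defs where

open import Data.Nat using (ℕ; zero; suc; _+_; _*_; _∸_; _≤_; _<_)
open import Data.Nat.Combinatorics using (_C_)
open import Data.Fin using (Fin)
import Data.Fin as F
open import Data.Fin.Subset using (Subset; _∉_; ∣_∣)
open import Data.List using (List; []; _∷_; length)
open import Data.List.Membership.Propositional using (_∈_)
open import Data.Product using (_×_; _,_; Σ; ∃)
open import Data.Sum using (_⊎_)
open import Relation.Nullary using (¬_)

-- A simple graph on vertex set Fin n, given by its list of edges.
-- Each edge is stored as an ordered pair (i , j) with i < j; the game only
-- ever adds new edges, so the list has no repetitions and |E(G)| = length.
Graph : ℕ → Set
Graph n = List (Fin n × Fin n)

emptyGraph : ∀ {n} → Graph n
emptyGraph = []

numEdges : ∀ {n} → Graph n → ℕ
numEdges = length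

Adj : ∀ {n} → Graph n → Fin n → Fin n → Set
Adj G x y = ((x , y) ∈ G) ⊎ ((y , x) ∈ G)

NonEdge : ∀ {n} → Graph n → Fin n × Fin n → Set
NonEdge G (i , j) = (i F.< j) × ¬ ((i , j) ∈ G)

addEdge : ∀ {n} → Graph n → Fin n × Fin n → Graph n
addEdge G e = e ∷ G

-- Reachability in G - S: a walk from x to y all of whose vertices
-- after the first avoid S (the first vertex is required to avoid S by the caller).
data Reach {n} (G : Graph n) (S : Subset n) : Fin n → Fin n → Set where
  here : ∀ {x} → Reach G S x x
  step : ∀ {x z y} → Adj G x z → z ∉ S → Reach G S z y → Reach G S x y

ConnectedMinus : ∀ {n} → Graph n → Subset n → Set
ConnectedMinus {n} G S = ∀ (x y : Fin n) → x ∉ S → y ∉ S → Reach G S x y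

KConnected : ℕ → ∀ {n} → Graph n → Set
KConnected k {n} G = (k < n) × (∀ (S : Subset n) → ∣ S ∣ < k → ConnectedMinus G S)

Legal : ∀ {n} → (Graph n → Set) → Graph n → Fin n × Fin n → Set
Legal P G e = NonEdge G e × ¬ P (addEdge G e)

Final : ∀ {n} → (Graph n → Set) → Graph n → Set
Final P G = ∀ e → ¬ Legal P G e

data Player : Set where
  Mini Max : Player

-- MaxForces P t p G : in the position G with player p to move, Max has a
-- strategy guaranteeing that the final graph has at least t edges, against
-- every strategy of Mini. Hence  s ≥ t  iff  MaxForces P t first emptyGraph.
data MaxForces {n} (P : Graph n → Set) (t : ℕ) : Player → Graph n → Set where
  done    : ∀ {p G} → Final P G → t ≤ numEdges G → MaxForces P t p G
  maxMove : ∀ {G} e → Legal P G e → MaxForces P t Mini (addEdge G e) → MaxForces P t Max G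
  miniMove : ∀ {G} → (∃ λ e → Legal P G e) →
             (∀ e → Legal P G e → MaxForces P t Max (addEdge G e)) →
             MaxForces P t Mini G

ScoreAtLeast : (n : ℕ) → (Graph n → Set) → Player → ℕ → Set
ScoreAtLeast n P first t = MaxForces P t first (emptyGraph {n})

bound : ℕ → ℕ → ℕ
bound k n = (n C 2) ∸ ((k ∸ 1) * (2 * k ∸ 4)) * (n ∸ (k ∸ 1) * (2 * k ∸ 3))

{-# OPTIONS --safe #-}

-- A k-connected graph on n vertices has at least kn/2 edges, so as long as fewer edges have been
-- played every move is legal.  During that time Max can build any fixed graph H with 2(2|H| + 1) < kn;
-- the edges added by Mini never hurt.  H is chosen such that deleting fewer than k vertices leaves all
-- but a < m = (k-1)(2k-4) of the others in one component:
--   * k vertices form a clique and are joined to all of O(k + n/k) "hubs", split into rows and columns;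
--   * the remaining vertices form stars with four leaves, and the centre of each star is joined to one
--     row hub and one column hub, distinct stars receiving distinct pairs.
-- A star is cut off only if its centre or both its hubs are deleted, so at most 5(p + rc) vertices are
-- lost when p centres, r row hubs and c column hubs are deleted.
-- The final graph is saturated, so each of its missing edges meets a lost vertex of some separation;
-- hence at most a n ≤ (m - 1) n edges are missing, and (m - 1) n ≤ m (n - (k-1)(2k-3)) for large n.
module Submission where

open import Defs
import Algebra.Properties.CommutativeMonoid.Sum
open import Data.Bool using (if_then_else_)
open import Data.Fin as Fin using (Fin; toℕ; fromℕ<)
import Data.Fin.Properties as Fin
open import Data.Fin.Subset using (Subset; inside; outside; ∣_∣; ⁅_⁆; _∪_; ⊤; ⊥) renaming (_∈_ to _∈ˢ_; _∉_ to _∉ˢ_; _-_ to _-ˢ_)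
import Data.Fin.Subset.Properties as Subset
open import Data.List using (List; []; _∷_; [_]; _++_; length; map; filter; cartesianProductWith; cartesianProduct; upTo; allFin)
open import Data.List.Properties using (length-++; length-++-sucʳ; length-map; length-tabulate; length-upTo; length-filter)
open import Data.List.Membership.Propositional using (_∈_)
open import Data.List.Membership.Propositional.Properties
import Data.List.Membership.DecPropositional as DecMembership
open import Data.List.Relation.Binary.Subset.Propositional using (_⊆_)
import Data.List.Relation.Unary.All as All
open import Data.List.Relation.Unary.Any using (here; there)
open import Data.List.Relation.Unary.AllPairs using ([]; _∷_)
open import Data.List.Relation.Unary.Unique.Propositional using (Unique)
import Data.List.Relation.Unary.Unique.Propositional.Properties as Unique
open import Data.Nat
open import Data.Nat.Combinatorics using (_C_; nC1≡n; nCk+nC[k+1]≡[n+1]C[k+1])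
open import Data.Nat.DivMod
open import Data.Nat.Properties
open import Data.Nat.Solver using (module +-*-Solver)
open import Data.Product using (Σ; ∃; ∃₂; _×_; _,_; proj₁; proj₂)
open import Data.Product.Properties using (≡-dec; ,-injective)
open import Data.Sum using (_⊎_; inj₁; inj₂)
open import Data.Vec using ([]; _∷_; here; there)
open import Function using (_∘_; id)
open import Relation.Nullary using (¬_; Dec; yes; no; does; contradiction)
open import Relation.Nullary.Decidable using (_×-dec_; _⊎-dec_; ¬?; map′; decidable-stable; dec-true; dec-false)
open import Relation.Unary using (Decidable)
open import Relation.Binary using (tri<; tri≈; tri>)
open import Relation.Binary.PropositionalEquality using (_≡_; _≢_; refl; sym; trans; cong; cong₂; subst; module ≡-Reasoning)

open Algebra.Properties.CommutativeMonoid.Sum +-0-commutativeMonoid using (sum; ∑-distrib-+; sum-replicate-zero; sum-cong-≗)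

private
  variable
    A B D : Set
    n : ℕ

-- Lists

-- Pigeonhole for lists: delete the head of `xs` from `ys` and induct. It bounds the length of the
-- game, the number of missing edges and the number of lost vertices.
Unique-⊆⇒length≤ : ∀ {xs ys : List A} → Unique xs → xs ⊆ ys → length xs ≤ length ys
Unique-⊆⇒length≤ [] _ = z≤n
Unique-⊆⇒length≤ {xs = x ∷ xs} (x∉xs ∷ uniq) sub with ∈-∃++ (sub (here refl))
... | as , bs , refl = ≤-trans (s≤s (Unique-⊆⇒length≤ uniq sub′)) (≤-reflexive (sym (length-++-sucʳ as x bs)))
  where
  sub′ : xs ⊆ as ++ bs
  sub′ y∈xs with ∈-++⁻ as (sub (there y∈xs))
  ... | inj₁ y∈as           = ∈-++⁺ˡ y∈as
  ... | inj₂ (here refl)    = contradiction refl (All.lookup x∉xs y∈xs)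
  ... | inj₂ (there y∈bs)   = ∈-++⁺ʳ as y∈bs

length-cartesianProductWith : ∀ (f : A → B → D) xs ys →
  length (cartesianProductWith f xs ys) ≡ length xs * length ys
length-cartesianProductWith f []       ys = refl
length-cartesianProductWith f (x ∷ xs) ys =
  trans (length-++ (map (f x) ys)) (cong₂ _+_ (length-map (f x) ys) (length-cartesianProductWith f xs ys))

length-filter-¬ : ∀ {P : A → Set} (P? : Decidable P) xs →
  length (filter P? xs) + length (filter (¬? ∘ P?) xs) ≡ length xs
length-filter-¬ P? [] = refl
length-filter-¬ P? (x ∷ xs) with P? x
... | yes _ = cong suc (length-filter-¬ P? xs)
... | no  _ = trans (+-suc _ _) (cong suc (length-filter-¬ P? xs))

-- The recursion splits off the pairs containing `Fin.zero`, so that the length obeys Pascal's rule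
-- for `n C 2`.
orderedPairs : ∀ n → List (Fin n × Fin n)
orderedPairs zero    = []
orderedPairs (suc n) =
  map (λ j → Fin.zero , Fin.suc j) (allFin n) ++ map (λ (i , j) → Fin.suc i , Fin.suc j) (orderedPairs n)

length-orderedPairs : ∀ n → length (orderedPairs n) ≡ n C 2
length-orderedPairs zero    = refl
length-orderedPairs (suc n) = begin
  length (orderedPairs (suc n))       ≡⟨ length-++ (map _ (allFin n)) ⟩
  length (map _ (allFin n)) + length (map _ (orderedPairs n))
    ≡⟨ cong₂ _+_ (trans (length-map _ (allFin n)) (length-tabulate {n = n} id)) (length-map _ (orderedPairs n)) ⟩
  n + length (orderedPairs n)         ≡⟨ cong₂ _+_ (sym (nC1≡n n)) (length-orderedPairs n) ⟩
  n C 1 + n C 2                       ≡⟨ nCk+nC[k+1]≡[n+1]C[k+1] n 1 ⟩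
  suc n C 2                           ∎
  where open ≡-Reasoning

orderedPairs-unique : ∀ n → Unique (orderedPairs n)
orderedPairs-unique zero    = []
orderedPairs-unique (suc n) = Unique.++⁺
  (Unique.map⁺ (λ { refl → refl }) (Unique.allFin⁺ n))
  (Unique.map⁺ (λ { refl → refl }) (orderedPairs-unique n))
  disjoint
  where
  disjoint : ∀ {e} → ¬ (e ∈ map (λ j → Fin.zero , Fin.suc j) (allFin n) ×
                        e ∈ map (λ (i , j) → Fin.suc i , Fin.suc j) (orderedPairs n))
  disjoint (p , q) with ∈-map⁻ _ p | ∈-map⁻ _ q
  ... | _ , _ , refl | _ , _ , ()

∈-orderedPairs⁻ : ∀ n {i j} → (i , j) ∈ orderedPairs n → i Fin.< j
∈-orderedPairs⁻ (suc n) e∈ with ∈-++⁻ (map _ (allFin n)) e∈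
... | inj₁ p with ∈-map⁻ _ p
...   | _ , _ , refl = z<s
∈-orderedPairs⁻ (suc n) e∈ | inj₂ p with ∈-map⁻ _ p
...   | _ , q , refl = s<s (∈-orderedPairs⁻ n q)

-- Subsets

∣p∪q∣≤∣p∣+∣q∣ : ∀ (p q : Subset n) → ∣ p ∪ q ∣ ≤ ∣ p ∣ + ∣ q ∣
∣p∪q∣≤∣p∣+∣q∣ []            []            = z≤n
∣p∪q∣≤∣p∣+∣q∣ (inside  ∷ p) (inside  ∷ q) = s≤s (≤-trans (∣p∪q∣≤∣p∣+∣q∣ p q) (+-monoʳ-≤ ∣ p ∣ (n≤1+n _)))
∣p∪q∣≤∣p∣+∣q∣ (inside  ∷ p) (outside ∷ q) = s≤s (∣p∪q∣≤∣p∣+∣q∣ p q)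
∣p∪q∣≤∣p∣+∣q∣ (outside ∷ p) (inside  ∷ q) = ≤-trans (s≤s (∣p∪q∣≤∣p∣+∣q∣ p q)) (≤-reflexive (sym (+-suc ∣ p ∣ ∣ q ∣)))
∣p∪q∣≤∣p∣+∣q∣ (outside ∷ p) (outside ∷ q) = ∣p∪q∣≤∣p∣+∣q∣ p q

x∉p-x : ∀ (p : Subset n) x → x ∉ˢ p -ˢ x
x∉p-x (_ ∷ p) (Fin.suc x) (there x∈) = x∉p-x p x x∈

fromList : List (Fin n) → Subset n
fromList []       = ⊥
fromList (x ∷ xs) = ⁅ x ⁆ ∪ fromList xs

∈-fromList⁺ : ∀ {x : Fin n} {xs} → x ∈ xs → x ∈ˢ fromList xs
∈-fromList⁺ {x = x} (here refl) = Subset.x∈p∪q⁺ (inj₁ (Subset.x∈⁅x⁆ x))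
∈-fromList⁺ (there x∈xs)        = Subset.x∈p∪q⁺ (inj₂ (∈-fromList⁺ x∈xs))

∈-fromList⁻ : ∀ {x : Fin n} xs → x ∈ˢ fromList xs → x ∈ xs
∈-fromList⁻ []       x∈ = contradiction x∈ Subset.∉⊥
∈-fromList⁻ (y ∷ xs) x∈ with Subset.x∈p∪q⁻ ⁅ y ⁆ (fromList xs) x∈
... | inj₁ x∈y  = here (Subset.x∈⁅y⁆⇒x≡y y x∈y)
... | inj₂ x∈xs = there (∈-fromList⁻ xs x∈xs)

∣fromList∣≤length : ∀ (xs : List (Fin n)) → ∣ fromList xs ∣ ≤ length xs
∣fromList∣≤length {n = n} [] = ≤-reflexive (Subset.∣⊥∣≡0 n)
∣fromList∣≤length (x ∷ xs) = ≤-trans (∣p∪q∣≤∣p∣+∣q∣ ⁅ x ⁆ (fromList xs))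
  (+-mono-≤ (≤-reflexive (Subset.∣⁅x⁆∣≡1 x)) (∣fromList∣≤length xs))

elements : Subset n → List (Fin n)
elements []            = []
elements (inside  ∷ p) = Fin.zero ∷ map Fin.suc (elements p)
elements (outside ∷ p) = map Fin.suc (elements p)

∈-elements⁺ : ∀ {x : Fin n} {p} → x ∈ˢ p → x ∈ elements p
∈-elements⁺ {p = inside  ∷ p} here       = here refl
∈-elements⁺ {p = inside  ∷ p} (there x∈) = there (∈-map⁺ Fin.suc (∈-elements⁺ x∈))
∈-elements⁺ {p = outside ∷ p} (there x∈) = ∈-map⁺ Fin.suc (∈-elements⁺ x∈)

length-elements : ∀ (p : Subset n) → length (elements p) ≡ ∣ p ∣
length-elements []            = refl
length-elements (inside  ∷ p) = cong suc (trans (length-map Fin.suc (elements p)) (length-elements p))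
length-elements (outside ∷ p) = trans (length-map Fin.suc (elements p)) (length-elements p)

-- Used with `c` equal to `n`, to find a vertex outside a closed neighbourhood, and with `c` equal
-- to `k`, to find a surviving clique vertex.
∃∉-below : ∀ (p : Subset n) c → ∣ p ∣ < c → c ≤ n → ∃ λ x → toℕ x < c × x ∉ˢ p
∃∉-below (outside ∷ p) (suc c) _           _           = Fin.zero , z<s , λ ()
∃∉-below (inside  ∷ p) (suc c) (s≤s ∣p∣<c) (s≤s c≤n) with ∃∉-below p c ∣p∣<c c≤n
... | x , x<c , x∉p = Fin.suc x , s<s x<c , λ { (there x∈p) → x∉p x∈p }
∃∉-below []            zero    ()          _

-- Reachability

module _ {G : Graph n} {S : Subset n} where

  Reach-snoc : ∀ {x y z} → Reach G S x y → Adj G y z → z ∉ˢ S → Reach G S x z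
  Reach-snoc here             yz z∉S = step yz z∉S here
  Reach-snoc (step xw w∉S wy) yz z∉S = step xw w∉S (Reach-snoc wy yz z∉S)

  Reach-trans : ∀ {x y z} → Reach G S x y → Reach G S y z → Reach G S x z
  Reach-trans here             yz = yz
  Reach-trans (step xw w∉S wy) yz = step xw w∉S (Reach-trans wy yz)

  Reach-sym : ∀ {x y} → x ∉ˢ S → Reach G S x y → Reach G S y x
  Reach-sym x∉S here                    = here
  Reach-sym x∉S (step (inj₁ xw) w∉S wy) = Reach-snoc (Reach-sym w∉S wy) (inj₂ xw) x∉S
  Reach-sym x∉S (step (inj₂ xw) w∉S wy) = Reach-snoc (Reach-sym w∉S wy) (inj₁ xw) x∉S

infix 4 _∈?_
_∈?_ : ∀ (e : Fin n × Fin n) (G : Graph n) → Dec (e ∈ G)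
_∈?_ = DecMembership._∈?_ (≡-dec Fin._≟_ Fin._≟_)

Adj? : ∀ (G : Graph n) x y → Dec (Adj G x y)
Adj? G x y = ((x , y) ∈? G) ⊎-dec ((y , x) ∈? G)

module _ (G : Graph n) (S : Subset n) (x : Fin n) where

  -- Graph search: U is the set of vertices not visited so far.
  search : ∀ fuel (U : Subset n) → ∣ U ∣ < fuel → x ∉ˢ U →
           (∀ {y} → y ∉ˢ U → Reach G S x y) → ∀ y → Dec (Reach G S x y)
  search (suc fuel) U ∣U∣<fuel x∉U visited y
    with Fin.any? (λ u → Fin.any? (λ w → ¬? (u Subset.∈? U) ×-dec (w Subset.∈? U) ×-dec ¬? (w Subset.∈? S) ×-dec Adj? G u w))
  ... | yes (u , w , u∉U , w∈U , w∉S , uw) =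
    search fuel (U -ˢ w) (≤-trans (Subset.x∈p⇒∣p-x∣<∣p∣ w∈U) (≤-pred ∣U∣<fuel))
      (λ x∈ → x∉U (Subset.p─q⊆p U ⁅ w ⁆ x∈)) visited′ y
    where
    visited′ : ∀ {v} → v ∉ˢ U -ˢ w → Reach G S x v
    visited′ {v} v∉ with v Fin.≟ w
    ... | yes refl = Reach-snoc (visited u∉U) uw w∉S
    ... | no v≢w   = visited (λ v∈U → v∉ (Subset.x∈p∧x≢y⇒x∈p-y v∈U v≢w))
  ... | no closed with y Subset.∈? U
  ...   | no y∉U  = yes (visited y∉U)
  ...   | yes y∈U = no (λ xy → stays xy x∉U y∈U)
    where
    -- No edge leads from a visited vertex to one of `U` outside `S`, so a walk that starts outside
    -- `U` never enters it.
    stays : ∀ {u v} → Reach G S u v → u ∉ˢ U → v ∉ˢ U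
    stays here                         u∉U = u∉U
    stays (step {z = w} uw w∉S wv) u∉U =
      stays wv (λ w∈U → closed (_ , w , u∉U , w∈U , w∉S , uw))

  Reach? : ∀ y → Dec (Reach G S x y)
  Reach? = search (suc ∣ U₀ ∣) U₀ ≤-refl (x∉p-x ⊤ x) visited₀
    where
    U₀ = ⊤ -ˢ x

    visited₀ : ∀ {y} → y ∉ˢ U₀ → Reach G S x y
    visited₀ {y} y∉ with y Fin.≟ x
    ... | yes refl = here
    ... | no y≢x   = contradiction (Subset.x∈p∧x≢y⇒x∈p-y Subset.∈⊤ y≢x) y∉

-- Separations and decidability of k-connectivity

Separation : ℕ → Graph n → Set
Separation {n} k G = ∃ λ (S : Subset n) → ∣ S ∣ < k × ∃₂ λ x y → x ∉ˢ S × y ∉ˢ S × ¬ Reach G S x y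

Separation? : ∀ k (G : Graph n) → Dec (Separation k G)
Separation? k G = Subset.anySubset? λ S → (∣ S ∣ <? k) ×-dec
  Fin.any? λ x → Fin.any? λ y → ¬? (x Subset.∈? S) ×-dec ¬? (y Subset.∈? S) ×-dec ¬? (Reach? G S x y)

¬Separation⇒KConnected : ∀ {k} {G : Graph n} → k < n → ¬ Separation k G → KConnected k G
¬Separation⇒KConnected {G = G} k<n ¬sep = k<n , λ S ∣S∣<k x y x∉S y∉S →
  decidable-stable (Reach? G S x y) λ ¬xy → ¬sep (S , ∣S∣<k , x , y , x∉S , y∉S , ¬xy)

-- The search for a separation is finite, so the double negation can be removed and a witness
-- extracted constructively.
¬KConnected⇒Separation : ∀ {k} {G : Graph n} → k < n → ¬ KConnected k G → Separation k G
¬KConnected⇒Separation {k = k} {G} k<n ¬conn =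
  decidable-stable (Separation? k G) (¬conn ∘ ¬Separation⇒KConnected k<n)

KConnected? : ∀ k (G : Graph n) → Dec (KConnected k G)
KConnected? {n} k G with k <? n | Separation? k G
... | no k≮n  | _       = no (k≮n ∘ proj₁)
... | yes k<n | no ¬sep = yes (¬Separation⇒KConnected k<n ¬sep)
... | yes _   | yes (S , ∣S∣<k , x , y , x∉S , y∉S , ¬xy) =
  no λ (_ , conn) → ¬xy (conn S ∣S∣<k x y x∉S y∉S)

-- Degrees

-- The contribution of one end of an edge to the neighbour list of `v`. Summed over all `v` its
-- length is 1, so the handshake identity holds for arbitrary lists, even with loops or repetitions.
edgeEnd : Fin n → Fin n → A → List A
edgeEnd x v b = if does (x Fin.≟ v) then [ b ] else []

neighbours : Graph n → Fin n → List (Fin n)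
neighbours []            v = []
neighbours ((x , y) ∷ G) v = edgeEnd x v y ++ edgeEnd y v x ++ neighbours G v

∈-edgeEnd : ∀ (v : Fin n) (b : A) → b ∈ edgeEnd v v b
∈-edgeEnd v b with v Fin.≟ v
... | yes _  = here refl
... | no v≢v = contradiction refl v≢v

∈-neighbours : ∀ (G : Graph n) {v w} → Adj G v w → w ∈ neighbours G v
∈-neighbours (_ ∷ G) {v} {w} (inj₁ (here refl)) = ∈-++⁺ˡ (∈-edgeEnd v w)
∈-neighbours ((x , y) ∷ G) {v} {w} (inj₂ (here refl)) = ∈-++⁺ʳ (edgeEnd w v v) (∈-++⁺ˡ (∈-edgeEnd v w))
∈-neighbours ((x , y) ∷ G) {v} (inj₁ (there e∈)) = ∈-++⁺ʳ (edgeEnd x v y) (∈-++⁺ʳ (edgeEnd y v x) (∈-neighbours G (inj₁ e∈)))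
∈-neighbours ((x , y) ∷ G) {v} (inj₂ (there e∈)) = ∈-++⁺ʳ (edgeEnd x v y) (∈-++⁺ʳ (edgeEnd y v x) (∈-neighbours G (inj₂ e∈)))

sum-edgeEnd : ∀ (x : Fin n) (b : A) → sum (λ v → length (edgeEnd x v b)) ≡ 1
sum-edgeEnd {n = suc n} Fin.zero    b = cong suc (sum-replicate-zero n)
sum-edgeEnd             (Fin.suc x) b = sum-edgeEnd x b

handshake : ∀ (G : Graph n) → sum (λ v → length (neighbours G v)) ≡ 2 * numEdges G
handshake {n} [] = sum-replicate-zero n
handshake ((x , y) ∷ G) = begin
  sum (λ v → length (neighbours ((x , y) ∷ G) v))
    ≡⟨ sum-cong-≗ (λ v → trans (length-++ (edgeEnd x v y)) (cong (length (edgeEnd x v y) +_) (length-++ (edgeEnd y v x)))) ⟩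
  sum (λ v → length (edgeEnd x v y) + (length (edgeEnd y v x) + length (neighbours G v)))
    ≡⟨ trans (∑-distrib-+ (λ v → length (edgeEnd x v y)) _)
         (cong (sum (λ v → length (edgeEnd x v y)) +_) (∑-distrib-+ (λ v → length (edgeEnd y v x)) _)) ⟩
  sum (λ v → length (edgeEnd x v y)) + (sum (λ v → length (edgeEnd y v x)) + sum (λ v → length (neighbours G v)))
    ≡⟨ cong₂ _+_ (sum-edgeEnd x y) (cong₂ _+_ (sum-edgeEnd y x) (handshake G)) ⟩
  2 + 2 * numEdges G                     ≡⟨ *-distribˡ-+ 2 1 (numEdges G) ⟨
  2 * numEdges ((x , y) ∷ G)             ∎
  where open ≡-Reasoning

sum-lower-bound : ∀ {k} (f : Fin n → ℕ) → (∀ v → k ≤ f v) → n * k ≤ sum f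
sum-lower-bound {zero}  f k≤f = z≤n
sum-lower-bound {suc n} f k≤f = +-mono-≤ (k≤f Fin.zero) (sum-lower-bound (f ∘ Fin.suc) (k≤f ∘ Fin.suc))

-- Deleting the neighbours of a vertex of degree below `k` isolates it, and since `k < n` some other
-- vertex remains.
KConnected⇒degree≥k : ∀ {k} {G : Graph n} → KConnected k G → ∀ v → k ≤ length (neighbours G v)
KConnected⇒degree≥k {n} {k} {G} (k<n , conn) v = ≮⇒≥ λ deg<k →
  let y , _ , y∉N = ∃∉-below (fromList (v ∷ N)) n
                      (≤-trans (s≤s (≤-trans (∣fromList∣≤length (v ∷ N)) deg<k)) k<n) ≤-refl
      y≢v : y ≢ v
      y≢v y≡v = y∉N (∈-fromList⁺ {xs = v ∷ N} (here y≡v))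
      y∉S = λ y∈S → y∉N (∈-fromList⁺ (there (proj₁ (∈-filter⁻ ≢v? {xs = N} (∈-fromList⁻ N′ y∈S)))))
  in isolated y≢v (conn S (≤-trans (s≤s (≤-trans (∣fromList∣≤length N′) (length-filter ≢v? N))) deg<k) v y v∉S y∉S)
  where
  -- A `Graph` may contain loops, so `v` has to be kept out of the deleted set explicitly.
  ≢v? = λ u → ¬? (u Fin.≟ v)
  N  = neighbours G v
  N′ = filter ≢v? N
  S  = fromList N′

  v∉S : v ∉ˢ S
  v∉S v∈S = proj₂ (∈-filter⁻ ≢v? {xs = N} (∈-fromList⁻ N′ v∈S)) refl

  isolated : ∀ {y} → y ≢ v → ¬ Reach G S v y
  isolated y≢v here = y≢v refl
  isolated y≢v (step {z = z} vz z∉S zy) with z Fin.≟ v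
  ... | yes refl = isolated y≢v zy
  ... | no z≢v   = z∉S (∈-fromList⁺ (∈-filter⁺ ≢v? (∈-neighbours G vz) z≢v))

sparse⇒¬KConnected : ∀ {k} (G : Graph n) → 2 * numEdges G < n * k → ¬ KConnected k G
sparse⇒¬KConnected G sparse conn = <⇒≱ sparse
  (≤-trans (sum-lower-bound _ (KConnected⇒degree≥k conn)) (≤-reflexive (handshake G)))

-- The game

-- Target edges are given by the numbers of their end vertices; those not of the form i < j < n are void.
Contains : List (ℕ × ℕ) → Graph n → Set
Contains {n} T G = ∀ {i j : Fin n} → i Fin.< j → (toℕ i , toℕ j) ∈ T → (i , j) ∈ G

module Game {n : ℕ} (k : ℕ) where

  NonEdge? : ∀ (G : Graph n) e → Dec (NonEdge G e)
  NonEdge? G (i , j) = (i Fin.<? j) ×-dec ¬? ((i , j) ∈? G)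

  Legal? : ∀ (G : Graph n) e → Dec (Legal (KConnected k) G e)
  Legal? G e = NonEdge? G e ×-dec ¬? (KConnected? k (addEdge G e))

  anyEdge? : ∀ {P : Fin n × Fin n → Set} → Decidable P → Dec (∃ P)
  anyEdge? P? = map′ (λ (i , j , p) → (i , j) , p) (λ ((i , j) , p) → i , j , p)
                  (Fin.any? λ i → Fin.any? λ j → P? (i , j))

  anyLegal? : ∀ (G : Graph n) → Dec (∃ (Legal (KConnected k) G))
  anyLegal? G = anyEdge? (Legal? G)

  allPairs : List (Fin n × Fin n)
  allPairs = cartesianProduct (allFin n) (allFin n)

  ∈-allPairs : ∀ {xs} → xs ⊆ allPairs
  ∈-allPairs {x = i , j} _ = ∈-cartesianProduct⁺ (∈-allFin i) (∈-allFin j)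

  Unique-addEdge : ∀ {G : Graph n} {e} → Unique G → NonEdge G e → Unique (addEdge G e)
  Unique-addEdge uniq (_ , e∉G) = All.tabulate (λ { e∈G refl → e∉G e∈G }) ∷ uniq

  sparse⇒legal : ∀ {G : Graph n} {e} → 2 * suc (numEdges G) < n * k → NonEdge G e → Legal (KConnected k) G e
  sparse⇒legal {G} {e} sparse nonEdge = nonEdge , sparse⇒¬KConnected (addEdge G e) sparse

  module Strategy (t : ℕ) (T : List (ℕ × ℕ))
    (win : ∀ {G : Graph n} → Final (KConnected k) G → ¬ KConnected k G → Contains T G → t ≤ numEdges G) where

    Contains-addEdge : ∀ {G : Graph n} {e} → Contains T G → Contains T (addEdge G e)
    Contains-addEdge T⊆G i<j ij∈T = there (T⊆G i<j ij∈T)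

    -- Once the target edges are present, `win` applies to every final position that can follow, so
    -- Max may play any legal edge. The played edges are distinct, so there are at most
    -- `length allPairs` of them; `fuel` bounds the moves left.
    playOn : ∀ fuel p {G : Graph n} → length allPairs ≤ fuel + numEdges G → Unique G → ¬ KConnected k G → Contains T G →
             MaxForces (KConnected k) t p G
    playOn fuel p {G} enough uniq ¬conn T⊆G with anyLegal? G
    ... | no final = done (λ e legal → final (e , legal)) (win (λ e legal → final (e , legal)) ¬conn T⊆G)
    playOn zero p enough uniq ¬conn T⊆G | yes (e , nonEdge , _) =
      contradiction enough (<⇒≱ (Unique-⊆⇒length≤ (Unique-addEdge uniq nonEdge) ∈-allPairs))
    playOn (suc fuel) Max {G} enough uniq ¬conn T⊆G | yes (e , legal@(nonEdge , ¬conn′)) =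
      maxMove e legal (playOn fuel Mini (≤-trans enough (≤-reflexive (sym (+-suc fuel (numEdges G)))))
        (Unique-addEdge uniq nonEdge) ¬conn′ (Contains-addEdge T⊆G))
    playOn (suc fuel) Mini {G} enough uniq ¬conn T⊆G | yes legal =
      miniMove legal λ e (nonEdge , ¬conn′) →
        playOn fuel Max (≤-trans enough (≤-reflexive (sym (+-suc fuel (numEdges G)))))
          (Unique-addEdge uniq nonEdge) ¬conn′ (Contains-addEdge T⊆G)

    -- es lists the target edges that may still be absent from G.
    Covers : List (ℕ × ℕ) → Graph n → Set
    Covers es G = ∀ {i j : Fin n} → i Fin.< j → (toℕ i , toℕ j) ∈ T → (i , j) ∈ G ⊎ (toℕ i , toℕ j) ∈ es

    Covers-addEdge : ∀ {es G e} → Covers es G → Covers es (addEdge G e)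
    Covers-addEdge cov i<j ij∈T with cov i<j ij∈T
    ... | inj₁ ij∈G  = inj₁ (there ij∈G)
    ... | inj₂ ij∈es = inj₂ ij∈es

    Covers-[] : ∀ {G : Graph n} → Covers [] G → Contains T G
    Covers-[] cov i<j ij∈T with cov i<j ij∈T
    ... | inj₁ ij∈G = ij∈G

    code : Fin n × Fin n → ℕ × ℕ
    code (i , j) = toℕ i , toℕ j

    code-injective : ∀ {e e′} → code e ≡ code e′ → e ≡ e′
    code-injective eq = cong₂ _,_ (Fin.toℕ-injective (proj₁ (,-injective eq))) (Fin.toℕ-injective (proj₂ (,-injective eq)))

    Covers-∷-played : ∀ {es G e} → Covers (code e ∷ es) G → Covers es (addEdge G e)
    Covers-∷-played cov i<j ij∈T with cov i<j ij∈T
    ... | inj₁ ij∈G            = inj₁ (there ij∈G)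
    ... | inj₂ (here eq)       = inj₁ (here (code-injective eq))
    ... | inj₂ (there ij∈es)   = inj₂ ij∈es

    Covers-∷-skip : ∀ {es G c} → ¬ ∃ (λ e → NonEdge G e × code e ≡ c) → Covers (c ∷ es) G → Covers es G
    Covers-∷-skip {G = G} skip cov {i} {j} i<j ij∈T with cov i<j ij∈T
    ... | inj₁ ij∈G            = inj₁ ij∈G
    ... | inj₂ (there ij∈es)   = inj₂ ij∈es
    ... | inj₂ (here eq) with (i , j) ∈? G
    ...   | yes ij∈G = inj₁ ij∈G
    ...   | no ij∉G  = contradiction ((i , j) , (i<j , ij∉G) , eq) skip

    sparse-mono : ∀ a b → a ≤ b → 2 * b < n * k → 2 * a < n * k
    sparse-mono a b a≤b = ≤-trans (s≤s (*-monoʳ-≤ 2 a≤b))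

    -- Each outstanding target edge is charged two edges, Max's move and Mini's reply; the `suc` in
    -- `buildMini` pays for the move Mini is about to make. While the budget stays below `n * k`,
    -- every non-edge is legal, so Mini cannot block a target edge.
    buildMax : ∀ es {G : Graph n} → 2 * (numEdges G + 2 * length es) < n * k → Unique G → Covers es G →
               MaxForces (KConnected k) t Max G
    buildMini : ∀ es {G : Graph n} → 2 * suc (numEdges G + 2 * length es) < n * k → Unique G → Covers es G →
                MaxForces (KConnected k) t Mini G

    buildMax [] {G} sparse uniq cov =
      playOn (length allPairs) Max (m≤m+n _ _) uniq
        (sparse⇒¬KConnected G (sparse-mono (numEdges G) (numEdges G + 0) (m≤m+n _ _) sparse)) (Covers-[] cov)
    buildMax (c ∷ es) {G} sparse uniq cov
      with anyEdge? (λ e → NonEdge? G e ×-dec ≡-dec _≟_ _≟_ (code e) c)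
    -- Here `c` is void or has already been played; Max proceeds to the next target edge without
    -- moving.
    ... | no skip = buildMax es
      (sparse-mono (numEdges G + 2 * length es) _ (+-monoʳ-≤ (numEdges G) (*-monoʳ-≤ 2 (n≤1+n (length es)))) sparse)
      uniq (Covers-∷-skip skip cov)
    ... | yes (e , nonEdge , refl) =
      maxMove e
        (sparse⇒legal (sparse-mono (suc (numEdges G)) _
          (≤-trans (s≤s (m≤m+n _ _)) (≤-trans (n≤1+n _) (≤-reflexive (sym count)))) sparse) nonEdge)
        (buildMini es (sparse-mono (2 + (numEdges G + 2 * length es)) _ (≤-reflexive (sym count)) sparse)
          (Unique-addEdge uniq nonEdge) (Covers-∷-played cov))
      where
      count : numEdges G + 2 * suc (length es) ≡ 2 + (numEdges G + 2 * length es)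
      count = solve 2 (λ g l → g :+ con 2 :* (con 1 :+ l) := con 2 :+ (g :+ con 2 :* l)) refl (numEdges G) (length es)
        where open +-*-Solver

    buildMini es {G} sparse uniq cov with anyLegal? G
    ... | yes legal = miniMove legal λ e (nonEdge , _) →
      buildMax es sparse (Unique-addEdge uniq nonEdge) (Covers-addEdge cov)
    -- By sparsity every non-edge would be legal, so here the graph is complete and contains `T`
    -- anyway.
    ... | no final = done (λ e legal → final (e , legal)) (win (λ e legal → final (e , legal))
      (sparse⇒¬KConnected G (sparse-mono (numEdges G) _ (≤-trans (m≤m+n _ _) (n≤1+n _)) sparse)) contains)
      where
      contains : Contains T G
      contains {i} {j} i<j _ = decidable-stable ((i , j) ∈? G) λ ij∉G →
        final ((i , j) , sparse⇒legal (sparse-mono (suc (numEdges G)) _ (s≤s (m≤m+n _ _)) sparse) (i<j , ij∉G))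

    forces : 2 * suc (2 * length T) < n * k → ∀ p → MaxForces (KConnected k) t p (emptyGraph {n})
    forces sparse Max  = buildMax T (sparse-mono (2 * length T) _ (n≤1+n _) sparse) [] (λ _ → inj₂)
    forces sparse Mini = buildMini T sparse [] (λ _ → inj₂)

-- Saturated graphs

module Saturated {n k : ℕ} {G : Graph n} (final : Final (KConnected k) G)
  {S : Subset n} (∣S∣<k : ∣ S ∣ < k) {z w : Fin n} (z∉S : z ∉ˢ S) (w∉S : w ∉ˢ S) (¬zw : ¬ Reach G S z w) where

  Lost : Fin n → Set
  Lost v = v ∉ˢ S × ¬ Reach G S z v

  Lost? : Decidable Lost
  Lost? v = ¬? (v Subset.∈? S) ×-dec ¬? (Reach? G S z v)

  lost : List (Fin n)
  lost = filter Lost? (allFin n)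

  -- If neither end is lost, each end lies in `S` or in the component of `z`. Adding the edge then
  -- leaves `z` and `w` separated by `S`, so the edge would be legal.
  missing-meets-Lost : ∀ {i j} → NonEdge G (i , j) → Lost i ⊎ Lost j
  missing-meets-Lost {i} {j} nonEdge = decidable-stable (Lost? i ⊎-dec Lost? j) λ ¬lost →
    final (i , j) (nonEdge , λ (_ , conn) → ¬zw (confined ¬lost here (conn S ∣S∣<k z w z∉S w∉S)))
    where
    reached : ∀ {v} → ¬ Lost v → v ∉ˢ S → Reach G S z v
    reached {v} ¬lost v∉S = decidable-stable (Reach? G S z v) (λ ¬zv → ¬lost (v∉S , ¬zv))

    confined : ¬ (Lost i ⊎ Lost j) → ∀ {u v} → Reach G S z u → Reach (addEdge G (i , j)) S u v → Reach G S z v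
    confined ¬lost zu here = zu
    confined ¬lost zu (step (inj₁ (here refl)) x∉S xv) = confined ¬lost (reached (¬lost ∘ inj₂) x∉S) xv
    confined ¬lost zu (step (inj₂ (here refl)) x∉S xv) = confined ¬lost (reached (¬lost ∘ inj₁) x∉S) xv
    confined ¬lost zu (step (inj₁ (there ux)) x∉S xv) = confined ¬lost (Reach-snoc zu (inj₁ ux) x∉S) xv
    confined ¬lost zu (step (inj₂ (there xu)) x∉S xv) = confined ¬lost (Reach-snoc zu (inj₂ xu) x∉S) xv

  sorted : Fin n → Fin n → Fin n × Fin n
  sorted u v = if does (u Fin.<? v) then (u , v) else (v , u)

  -- A generous count: `n` pairs for each lost vertex, including the degenerate pair of the vertex
  -- with itself.
  touching : List (Fin n × Fin n)
  touching = cartesianProductWith sorted lost (allFin n)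

  ∈-touching : ∀ {i j} → i Fin.< j → Lost i ⊎ Lost j → (i , j) ∈ touching
  ∈-touching {i} {j} i<j (inj₁ lost-i) = subst (_∈ touching)
    (cong (λ b → if b then (i , j) else (j , i)) (dec-true (i Fin.<? j) i<j))
    (∈-cartesianProductWith⁺ sorted (∈-filter⁺ Lost? (∈-allFin i) lost-i) (∈-allFin j))
  ∈-touching {i} {j} i<j (inj₂ lost-j) = subst (_∈ touching)
    (cong (λ b → if b then (j , i) else (i , j)) (dec-false (j Fin.<? i) (<-asym i<j)))
    (∈-cartesianProductWith⁺ sorted (∈-filter⁺ Lost? (∈-allFin j) lost-j) (∈-allFin i))

  pairs⊆ : orderedPairs n ⊆ G ++ touching
  pairs⊆ {i , j} ij∈ with (i , j) ∈? G
  ... | yes ij∈G = ∈-++⁺ˡ ij∈G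
  ... | no ij∉G  = ∈-++⁺ʳ G (∈-touching i<j (missing-meets-Lost (i<j , ij∉G)))
    where i<j = ∈-orderedPairs⁻ n ij∈

  nC2≤numEdges+lost*n : n C 2 ≤ numEdges G + length lost * n
  nC2≤numEdges+lost*n = begin
    n C 2                                       ≡⟨ length-orderedPairs n ⟨
    length (orderedPairs n)                     ≤⟨ Unique-⊆⇒length≤ (orderedPairs-unique n) pairs⊆ ⟩
    length (G ++ touching)                      ≡⟨ length-++ G ⟩
    numEdges G + length touching                ≡⟨ cong (numEdges G +_) (length-cartesianProductWith sorted lost (allFin n)) ⟩
    numEdges G + length lost * length (allFin n) ≡⟨ cong (λ m → numEdges G + length lost * m) (length-tabulate {n = n} id) ⟩
    numEdges G + length lost * n                ∎
    where open ≤-Reasoning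

-- The graph built by Max

-- The vertices below k are the clique; hubs are k + i for row i < R and k + R + i for column i < C.
-- From h on, vertices come in consecutive blocks of five: a star centre followed by its four leaves.
-- Block q belongs to row q % R and column q / R.
module Skeleton (k R C n : ℕ) .{{_ : NonZero R}} (n/R<C : n / R < C) where

  h : ℕ
  h = k + R + C

  rowHub colHub centre : ℕ → ℕ
  rowHub q = k + q % R
  colHub q = k + R + q / R
  centre q = h + q * 5

  -- The first argument is the offset within a block. Offset zero is the centre, which hangs from
  -- its row hub; the other four are leaves, which hang from the centre. Thus `leafEdges` also
  -- contains the edges from row hubs to centres.
  parent : ℕ → ℕ → ℕ
  parent zero    q = rowHub q
  parent (suc _) q = centre q

  -- The lists may include pairs in the wrong order or with an end beyond the last vertex. Such
  -- pairs are void and only make the length an overestimate.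
  hubEdges leafEdges centreEdges skeleton : List (ℕ × ℕ)
  hubEdges    = cartesianProduct (upTo k) (upTo h)
  leafEdges   = map (λ w → parent (w % 5) (w / 5) , h + w) (upTo n)
  centreEdges = map (λ q → colHub q , centre q) (upTo (suc (n / 5)))
  skeleton    = hubEdges ++ (leafEdges ++ centreEdges)

  length-skeleton : length skeleton ≡ k * h + (n + suc (n / 5))
  length-skeleton = begin
    length skeleton                                            ≡⟨ length-++ hubEdges ⟩
    length hubEdges + length (leafEdges ++ centreEdges)        ≡⟨ cong (length hubEdges +_) (length-++ leafEdges) ⟩
    length hubEdges + (length leafEdges + length centreEdges)
      ≡⟨ cong₂ _+_ (trans (length-cartesianProductWith _,_ (upTo k) (upTo h)) (cong₂ _*_ (length-upTo k) (length-upTo h)))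
           (cong₂ _+_ (trans (length-map _ (upTo n)) (length-upTo n))
                      (trans (length-map _ (upTo (suc (n / 5)))) (length-upTo (suc (n / 5))))) ⟩
    k * h + (n + suc (n / 5))                                  ∎
    where open ≡-Reasoning

  hubEdge : ∀ {u v} → u < k → v < h → (u , v) ∈ skeleton
  hubEdge u<k v<h = ∈-++⁺ˡ (∈-cartesianProduct⁺ (∈-upTo⁺ u<k) (∈-upTo⁺ v<h))

  leafEdge : ∀ {w} → w < n → (parent (w % 5) (w / 5) , h + w) ∈ skeleton
  leafEdge w<n = ∈-++⁺ʳ hubEdges (∈-++⁺ˡ (∈-map⁺ _ (∈-upTo⁺ w<n)))

  rowEdge : ∀ {q} → q * 5 < n → (rowHub q , centre q) ∈ skeleton
  rowEdge {q} 5q<n = subst (λ p → (p , centre q) ∈ skeleton)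
    (cong₂ parent (m*n%n≡0 q 5) (m*n/n≡m q 5)) (leafEdge 5q<n)

  colEdge : ∀ {q} → q ≤ n / 5 → (colHub q , centre q) ∈ skeleton
  colEdge q≤ = ∈-++⁺ʳ hubEdges (∈-++⁺ʳ leafEdges (∈-map⁺ _ (∈-upTo⁺ (s≤s q≤))))

  rowHub<k+R : ∀ q → rowHub q < k + R
  rowHub<k+R q = +-monoʳ-< k (m%n<n q R)

  rowHub<h : ∀ q → rowHub q < h
  rowHub<h q = ≤-trans (rowHub<k+R q) (m≤m+n (k + R) C)

  -- The hypothesis `n/R<C` supplies enough columns for every block number up to `n`.
  colHub<h : ∀ {q} → q ≤ n → colHub q < h
  colHub<h q≤n = +-monoʳ-< (k + R) (≤-trans (s≤s (/-monoˡ-≤ R q≤n)) n/R<C)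

  -- Vertices cut off when a set is deleted from the skeleton

  module Cut {G : Graph n} (T⊆G : Contains skeleton G) {S : Subset n}
    {z : Fin n} (z<k : toℕ z < k) (z∉S : z ∉ˢ S) where

    InS : ℕ → Set
    InS a = ∃ λ (x : Fin n) → x ∈ˢ S × toℕ x ≡ a

    extend : ∀ {u v} → u Fin.< v → (toℕ u , toℕ v) ∈ skeleton → v ∉ˢ S → Reach G S z u → Reach G S z v
    extend u<v uv v∉S zu = Reach-snoc zu (inj₁ (T⊆G u<v uv)) v∉S

    reach-hub : ∀ {v} → toℕ v < h → v ∉ˢ S → Reach G S z v
    reach-hub {v} v<h v∉S with <-cmp (toℕ z) (toℕ v)
    ... | tri< z<v _ _ = extend z<v (hubEdge z<k v<h) v∉S here
    ... | tri≈ _ z≡v _ = subst (Reach G S z) (Fin.toℕ-injective z≡v) here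
    ... | tri> _ _ v<z = step (inj₂ (T⊆G v<z (hubEdge (<-trans v<z z<k) z<h))) v∉S here
      where z<h = ≤-trans z<k (≤-trans (m≤m+n k R) (m≤m+n (k + R) C))

    -- If the hub numbered `a` survived, it would be reached from `z` and would pass this on to `v`.
    hub-blocks : ∀ {a v} → a < h → h ≤ toℕ v → (a , toℕ v) ∈ skeleton → v ∉ˢ S → ¬ Reach G S z v → InS a
    hub-blocks {a} {v} a<h h≤v av v∉S ¬zv = u , decidable-stable (u Subset.∈? S) absurd , u≡a
      where
      a<v = ≤-trans a<h h≤v
      a<n = <-trans a<v (Fin.toℕ<n v)
      u   = fromℕ< a<n
      u≡a : toℕ u ≡ a
      u≡a = Fin.toℕ-fromℕ< a<n
      absurd = λ u∉S → ¬zv (extend (subst (_< toℕ v) (sym u≡a) a<v) (subst (λ b → (b , toℕ v) ∈ skeleton) (sym u≡a) av) v∉S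
                             (reach-hub (subst (_< h) (sym u≡a) a<h) u∉S))

    reach-leaf : ∀ {u v} w → toℕ u ≡ centre (w / 5) → toℕ v ≡ h + w → v ∉ˢ S → Reach G S z u → Reach G S z v
    reach-leaf {u} {v} w u≡ v≡ v∉S zu with w % 5 in eq
    -- At offset zero `v` is the centre `u` itself.
    ... | zero = subst (Reach G S z) (Fin.toℕ-injective (trans u≡ (trans (cong (h +_) (sym w≡)) (sym v≡)))) zu
      where
      w≡ : w ≡ w / 5 * 5
      w≡ = trans (m≡m%n+[m/n]*n w 5) (cong (_+ w / 5 * 5) eq)
    ... | suc r = extend u<v uv v∉S zu
      where
      w≡ : w ≡ suc r + w / 5 * 5
      w≡ = trans (m≡m%n+[m/n]*n w 5) (cong (_+ w / 5 * 5) eq)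
      5q<w : w / 5 * 5 < w
      5q<w = ≤-trans (s≤s (m≤n+m (w / 5 * 5) r)) (≤-reflexive (sym w≡))
      u<v : u Fin.< v
      u<v = ≤-trans (s≤s (≤-reflexive u≡)) (≤-trans (+-monoʳ-< h 5q<w) (≤-reflexive (sym v≡)))
      w<n : w < n
      w<n = ≤-trans (s≤s (≤-trans (m≤n+m w h) (≤-reflexive (sym v≡)))) (Fin.toℕ<n v)
      uv : (toℕ u , toℕ v) ∈ skeleton
      uv = subst (_∈ skeleton) (cong₂ _,_ (trans (cong (λ r → parent r (w / 5)) eq) (sym u≡)) (sym v≡)) (leafEdge w<n)

    BadBlock : ℕ → Set
    BadBlock q = InS (centre q) ⊎ (InS (rowHub q) × InS (colHub q))

    -- All surviving vertices below `h` are reached, so `v` lies in a block. If the centre of this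
    -- block survives, it is unreached as well, for otherwise it would lead to `v`; hence both its
    -- hubs are deleted.
    unreached⇒BadBlock : ∀ {v} → v ∉ˢ S → ¬ Reach G S z v → ∃ λ w → toℕ v ≡ h + w × BadBlock (w / 5)
    unreached⇒BadBlock {v} v∉S ¬zv = w , v≡ , bad
      where
      h≤v : h ≤ toℕ v
      h≤v = ≮⇒≥ λ v<h → ¬zv (reach-hub v<h v∉S)
      w = toℕ v ∸ h
      q = w / 5
      v≡ : toℕ v ≡ h + w
      v≡ = sym (m+[n∸m]≡n h≤v)
      -- The centre comes first in its block, so it exists even when the last block is truncated.
      centre≤v : centre q ≤ toℕ v
      centre≤v = ≤-trans (+-monoʳ-≤ h (m/n*n≤m w 5)) (≤-reflexive (sym v≡))
      centre<n : centre q < n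
      centre<n = ≤-trans (s≤s centre≤v) (Fin.toℕ<n v)
      w≤n : w ≤ n
      w≤n = ≤-trans (m∸n≤m (toℕ v) h) (<⇒≤ (Fin.toℕ<n v))
      u = fromℕ< centre<n
      u≡ : toℕ u ≡ centre q
      u≡ = Fin.toℕ-fromℕ< centre<n
      h≤u : h ≤ toℕ u
      h≤u = ≤-trans (m≤m+n h (q * 5)) (≤-reflexive (sym u≡))
      bad : BadBlock q
      bad with u Subset.∈? S
      ... | yes u∈S = inj₁ (u , u∈S , u≡)
      ... | no u∉S  = inj₂
        ( hub-blocks (rowHub<h q) h≤u
            (subst (λ c → (rowHub q , c) ∈ skeleton) (sym u≡) (rowEdge (≤-trans (s≤s (m≤n+m (q * 5) h)) centre<n))) u∉S ¬zu
        , hub-blocks (colHub<h (≤-trans (m/n≤m w 5) w≤n)) h≤u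
            (subst (λ c → (colHub q , c) ∈ skeleton) (sym u≡) (colEdge (/-monoˡ-≤ 5 w≤n))) u∉S ¬zu )
        where
        ¬zu : ¬ Reach G S z u
        ¬zu zu = ¬zv (reach-leaf w u≡ v≡ v∉S zu)

    -- A coarse partition of `S`: `centres` takes in deleted leaves and `rows` takes in deleted
    -- clique vertices. Only the sum of the three sizes matters, and extra candidates do no harm to
    -- the upper bound.
    cut low centres rows columns blocks candidates : List ℕ
    cut        = map toℕ (elements S)
    centres    = filter (h ≤?_) cut
    low        = filter (¬? ∘ (h ≤?_)) cut
    rows       = filter (_<? k + R) low
    columns    = filter (¬? ∘ (_<? k + R)) low
    blocks     = map (λ c → (c ∸ h) / 5) centres
                 ++ cartesianProductWith (λ a b → (a ∸ k) + (b ∸ (k + R)) * R) rows columns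
    candidates = cartesianProductWith (λ q r → h + (r + q * 5)) blocks (upTo 5)

    length-cut : length centres + (length rows + length columns) ≡ ∣ S ∣
    length-cut = begin
      length centres + (length rows + length columns) ≡⟨ cong (length centres +_) (length-filter-¬ (_<? k + R) low) ⟩
      length centres + length low                     ≡⟨ length-filter-¬ (h ≤?_) cut ⟩
      length cut                                      ≡⟨ length-map toℕ (elements S) ⟩
      length (elements S)                             ≡⟨ length-elements S ⟩
      ∣ S ∣                                           ∎
      where open ≡-Reasoning

    length-candidates : length candidates ≡ (length centres + length rows * length columns) * 5
    length-candidates = begin
      length candidates          ≡⟨ length-cartesianProductWith _ blocks (upTo 5) ⟩
      length blocks * 5          ≡⟨ cong (_* 5) (length-++ (map _ centres)) ⟩
      (length (map _ centres) + length (cartesianProductWith _ rows columns)) * 5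
        ≡⟨ cong (_* 5) (cong₂ _+_ (length-map _ centres) (length-cartesianProductWith _ rows columns)) ⟩
      (length centres + length rows * length columns) * 5 ∎
      where open ≡-Reasoning

    InS⇒∈cut : ∀ {a} → InS a → a ∈ cut
    InS⇒∈cut (x , x∈S , refl) = ∈-map⁺ toℕ (∈-elements⁺ x∈S)

    BadBlock⇒∈blocks : ∀ {q} → q ≤ n → BadBlock q → q ∈ blocks
    BadBlock⇒∈blocks {q} _ (inj₁ c∈S) = ∈-++⁺ˡ (subst (_∈ map _ centres)
      (trans (cong (_/ 5) (m+n∸m≡n h (q * 5))) (m*n/n≡m q 5))
      (∈-map⁺ _ (∈-filter⁺ (h ≤?_) (InS⇒∈cut c∈S) (m≤m+n h (q * 5)))))
    -- Row and column are remainder and quotient of `q` by `R`, so together they determine `q`; at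
    -- most one block is lost per pair of a deleted row hub and a deleted column hub.
    BadBlock⇒∈blocks {q} q≤n (inj₂ (a∈S , b∈S)) = ∈-++⁺ʳ (map _ centres) (subst (_∈ cartesianProductWith _ rows columns)
      (trans (cong₂ (λ r s → r + s * R) (m+n∸m≡n k (q % R)) (m+n∸m≡n (k + R) (q / R))) (sym (m≡m%n+[m/n]*n q R)))
      (∈-cartesianProductWith⁺ _
        (∈-filter⁺ (_<? k + R) (∈-filter⁺ (¬? ∘ (h ≤?_)) (InS⇒∈cut a∈S) (<⇒≱ (rowHub<h q))) (rowHub<k+R q))
        (∈-filter⁺ (¬? ∘ (_<? k + R)) (∈-filter⁺ (¬? ∘ (h ≤?_)) (InS⇒∈cut b∈S) (<⇒≱ (colHub<h q≤n)))
          (≤⇒≯ (m≤m+n (k + R) (q / R))))))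

    unreached⇒candidate : ∀ {v} → v ∉ˢ S → ¬ Reach G S z v → toℕ v ∈ candidates
    unreached⇒candidate {v} v∉S ¬zv with unreached⇒BadBlock v∉S ¬zv
    ... | w , v≡ , bad = subst (_∈ candidates)
      (trans (cong (h +_) (sym (m≡m%n+[m/n]*n w 5))) (sym v≡))
      (∈-cartesianProductWith⁺ _ (BadBlock⇒∈blocks q≤n bad) (∈-upTo⁺ (m%n<n w 5)))
      where
      q≤n : w / 5 ≤ n
      q≤n = ≤-trans (m/n≤m w 5) (≤-trans (m≤n+m w h) (≤-trans (≤-reflexive (sym v≡)) (<⇒≤ (Fin.toℕ<n v))))

-- Numerical estimates

4*m*n≤[m+n]*[m+n] : ∀ m n → 4 * (m * n) ≤ (m + n) * (m + n)
4*m*n≤[m+n]*[m+n] m n with ≤-total m n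
-- With `d` the difference, the gap between the two sides is exactly `d * d`.
... | inj₁ m≤n with d , refl ← m≤n⇒∃[o]m+o≡n m≤n = ≤-trans (m≤m+n _ (d * d)) (≤-reflexive (lemma m d))
  where
  open +-*-Solver
  lemma : ∀ m d → 4 * (m * (m + d)) + d * d ≡ (m + (m + d)) * (m + (m + d))
  lemma = solve 2 (λ m d → con 4 :* (m :* (m :+ d)) :+ d :* d := (m :+ (m :+ d)) :* (m :+ (m :+ d))) refl
... | inj₂ n≤m with d , refl ← m≤n⇒∃[o]m+o≡n n≤m = ≤-trans (m≤m+n _ (d * d)) (≤-reflexive (lemma n d))
  where
  open +-*-Solver
  lemma : ∀ n d → 4 * ((n + d) * n) + d * d ≡ ((n + d) + n) * ((n + d) + n)
  lemma = solve 2 (λ n d → con 4 :* ((n :+ d) :* n) :+ d :* d := ((n :+ d) :+ n) :* ((n :+ d) :+ n)) refl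

-- By AM-GM and s ≥ 4, p + r c ≤ s² / 4 where s = 4 + j; and 5 s / 4 < 6 + 2 j.
five-blocks< : ∀ j p r c → p + (r + c) ≤ 4 + j → (p + r * c) * 5 < (4 + j) * (6 + 2 * j)
five-blocks< j p r c p+r+c≤s = *-cancelˡ-< 4 _ _ (begin-strict
  4 * ((p + r * c) * 5)
    ≡⟨ solve 3 (λ p r c → con 4 :* ((p :+ r :* c) :* con 5) := con 5 :* (con 4 :* p :+ con 4 :* (r :* c))) refl p r c ⟩
  5 * (4 * p + 4 * (r * c))
    ≤⟨ *-monoʳ-≤ 5 (+-mono-≤ (*-monoˡ-≤ p (m≤m+n 4 j))
         (≤-trans (4*m*n≤[m+n]*[m+n] r c) (*-monoˡ-≤ (r + c) r+c≤s))) ⟩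
  5 * (s * p + s * (r + c))          ≡⟨ cong (5 *_) (*-distribˡ-+ s p (r + c)) ⟨
  5 * (s * (p + (r + c)))            ≤⟨ *-monoʳ-≤ 5 (*-monoʳ-≤ s p+r+c≤s) ⟩
  5 * (s * s)                        <⟨ m<m+n (5 * (s * s)) z<s ⟩
  5 * (s * s) + s * (4 + 3 * j)
    ≡⟨ solve 1 (λ j → con 5 :* ((con 4 :+ j) :* (con 4 :+ j)) :+ (con 4 :+ j) :* (con 4 :+ con 3 :* j)
         := con 4 :* ((con 4 :+ j) :* (con 6 :+ con 2 :* j))) refl j ⟩
  4 * (s * (6 + 2 * j))              ∎)
  where
  open ≤-Reasoning
  open +-*-Solver
  s = 4 + j
  r+c≤s = ≤-trans (m≤n+m (r + c) p) p+r+c≤s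

-- As `a` is at most `m - 1`, the loss `a * n` is at most `m * n - n`; the spare `n` absorbs
-- `m * K`.
∸-bound : ∀ {N g a m n K} → N ≤ g + a * n → a < m → m * K ≤ n → N ∸ m * (n ∸ K) ≤ g
∸-bound {N} {g} {a} {m} {n} {K} N≤ a<m mK≤n = m≤n+o⇒m∸n≤o N _ (begin
  N                     ≤⟨ N≤ ⟩
  g + a * n             ≡⟨ +-comm g (a * n) ⟩
  a * n + g             ≡⟨ cong (_+ g) (m+n∸m≡n n (a * n)) ⟨
  (suc a * n ∸ n) + g   ≤⟨ +-monoˡ-≤ g (∸-mono (*-monoˡ-≤ n a<m) mK≤n) ⟩
  (m * n ∸ m * K) + g   ≡⟨ cong (_+ g) (*-distribˡ-∸ m n K) ⟨
  m * (n ∸ K) + g       ∎)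
  where open ≤-Reasoning

-- |H| ≤ n + n/5 + k (n/R) + O(k²); taking R = 40 k keeps this below 5n/4 ≤ kn/4.
skeleton-sparse : ∀ k n a b → 5 ≤ k → a * (40 * k) ≤ n → b * 5 ≤ n → 40 * (k * (k + 40 * k + 1)) + 60 < n →
  -- Scaling by 10 turns the hub term into `a * (40 * k)`, at most `n`, and the centre term into
  -- `8 * (b * 5)`, at most `8 * n`. With `40 * n` and less than `n` for the constants, the total
  -- stays below `50 * n`.
  2 * suc (2 * (k * (k + 40 * k + suc a) + (n + suc b))) < n * k
skeleton-sparse k n a b 5≤k 40ka≤n 5b≤n c<n = *-cancelˡ-< 10 _ _ (begin-strict
  10 * (2 * suc (2 * (k * (k + 40 * k + suc a) + (n + suc b))))
    ≡⟨ solve 4 (λ k n a b →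
         con 10 :* (con 2 :* (con 1 :+ con 2 :* (k :* (k :+ con 40 :* k :+ (con 1 :+ a)) :+ (n :+ (con 1 :+ b)))))
         := (con 40 :* (k :* (k :+ con 40 :* k :+ con 1)) :+ con 60)
            :+ (a :* (con 40 :* k) :+ con 8 :* (b :* con 5) :+ con 40 :* n)) refl k n a b ⟩
  (40 * (k * (k + 40 * k + 1)) + 60) + (a * (40 * k) + 8 * (b * 5) + 40 * n)
    <⟨ +-mono-<-≤ c<n (+-monoˡ-≤ (40 * n) (+-mono-≤ 40ka≤n (*-monoʳ-≤ 8 5b≤n))) ⟩
  n + (n + 8 * n + 40 * n)
    ≡⟨ solve 1 (λ n → n :+ (n :+ con 8 :* n :+ con 40 :* n) := con 10 :* (n :* con 5)) refl n ⟩
  10 * (n * 5)   ≤⟨ *-monoʳ-≤ 10 (*-monoʳ-≤ n 5≤k) ⟩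
  10 * (n * k)   ∎)
  where
  open ≤-Reasoning
  open +-*-Solver

-- Choice of parameters and conclusion

module _ (j : ℕ) where

  private
    k s m K sparseFrom : ℕ
    k = 5 + j
    s = k ∸ 1
    m = s * (2 * k ∸ 4)
    K = s * (2 * k ∸ 3)
    sparseFrom = 40 * (k * (k + 40 * k + 1)) + 60

  -- The summands ensure in turn `k < n`, the sparseness of the skeleton, and `m * K ≤ n` for
  -- `∸-bound`.
  threshold : ℕ
  threshold = suc k + (suc sparseFrom + m * K)

  m≡ : m ≡ (4 + j) * (6 + 2 * j)
  m≡ = cong ((4 + j) *_) (trans (cong (_∸ 4) (lemma j)) (m+n∸m≡n 4 (6 + 2 * j)))
    where
    open +-*-Solver
    lemma : ∀ j → 2 * (5 + j) ≡ 4 + (6 + 2 * j)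
    lemma = solve 1 (λ j → con 2 :* (con 5 :+ j) := con 4 :+ (con 6 :+ con 2 :* j)) refl

  module _ (n : ℕ) (n≥ : threshold ≤ n) where

    private
      k<n : k < n
      k<n = ≤-trans (m≤m+n (suc k) _) n≥

      sparseFrom<n : sparseFrom < n
      sparseFrom<n = ≤-trans (m≤m+n (suc sparseFrom) (m * K)) (≤-trans (m≤n+m _ (suc k)) n≥)

      m*K≤n : m * K ≤ n
      m*K≤n = ≤-trans (m≤n+m (m * K) (suc sparseFrom)) (≤-trans (m≤n+m _ (suc k)) n≥)

    open Skeleton k (40 * k) (suc (n / (40 * k))) n ≤-refl

    -- This is the `win` argument of the strategy: fewer than `m` vertices are lost, and every
    -- missing edge meets one of them.
    saturated-bound : ∀ {G : Graph n} → Final (KConnected k) G → ¬ KConnected k G → Contains skeleton G →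
                      bound k n ≤ numEdges G
    saturated-bound {G} final ¬conn T⊆G with ¬KConnected⇒Separation k<n ¬conn
    -- Fewer than `k` vertices are deleted, so a clique vertex `z` survives; both the lost vertices
    -- and the skeleton's cut are measured from it.
    ... | S , ∣S∣<k , x , y , x∉S , y∉S , ¬xy with ∃∉-below S k ∣S∣<k (<⇒≤ k<n)
    ...   | z , z<k , z∉S = count (unreached (Reach? G S z x))
      where
      -- Since `S` separates `x` from `y`, at least one of the two is unreachable from `z`.
      unreached : Dec (Reach G S z x) → ∃ λ w → w ∉ˢ S × ¬ Reach G S z w
      unreached (no ¬zx) = x , x∉S , ¬zx
      unreached (yes zx) = y , y∉S , λ zy → ¬xy (Reach-trans (Reach-sym z∉S zx) zy)

      count : (∃ λ w → w ∉ˢ S × ¬ Reach G S z w) → bound k n ≤ numEdges G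
      count (w , w∉S , ¬zw) = ∸-bound {m = m} {K = K} nC2≤numEdges+lost*n lost<m m*K≤n
        where
        open Saturated final ∣S∣<k z∉S w∉S ¬zw
        open Cut T⊆G z<k z∉S

        lost⊆candidates : map toℕ lost ⊆ candidates
        lost⊆candidates a∈ with ∈-map⁻ toℕ a∈
        ... | v , v∈lost , refl with ∈-filter⁻ Lost? {xs = allFin n} v∈lost
        ...   | _ , v∉S , ¬zv = unreached⇒candidate v∉S ¬zv

        lost<m : length lost < m
        lost<m = begin-strict
          length lost             ≡⟨ length-map toℕ lost ⟨
          length (map toℕ lost)
            ≤⟨ Unique-⊆⇒length≤ (Unique.map⁺ Fin.toℕ-injective (Unique.filter⁺ Lost? (Unique.allFin⁺ n))) lost⊆candidates ⟩
          length candidates       ≡⟨ length-candidates ⟩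
          (length centres + length rows * length columns) * 5
            <⟨ five-blocks< j (length centres) (length rows) (length columns) (≤-trans (≤-reflexive length-cut) (≤-pred ∣S∣<k)) ⟩
          (4 + j) * (6 + 2 * j)   ≡⟨ m≡ ⟨
          m                       ∎
          where open ≤-Reasoning

    Max-forces-bound : ∀ p → ScoreAtLeast n (KConnected k) p (bound k n)
    Max-forces-bound = forces (subst (λ l → 2 * suc (2 * l) < n * k) (sym length-skeleton)
      (skeleton-sparse k n (n / (40 * k)) (n / 5) (m≤m+n 5 j) (m/n*n≤m n (40 * k)) (m/n*n≤m n 5) sparseFrom<n))
      where open Game.Strategy k (bound k n) skeleton saturated-bound

theorem1p2 : ∀ (k : ℕ) → 5 ≤ k →
    Σ ℕ (λ n₀ → ∀ (n : ℕ) → n₀ ≤ n →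
    ScoreAtLeast n (KConnected k) Mini (bound k n) ×
    ScoreAtLeast n (KConnected k) Max (bound k n))
theorem1p2 k 5≤k with j , refl ← m≤n⇒∃[o]m+o≡n 5≤k =
  threshold j , λ n n≥ → Max-forces-bound j n n≥ Mini , Max-forces-bound j n n≥ Max
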